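{- Let $G=(X,\Gamma,M)$ be a trivial twin-orthogonal graph. Then every maximal independent set (MIS) of $G$ is also a maximum independent set (MMIS) of $G$.
   Context: A vertex-weighted graph $G=(X,\Gamma,M)$ is a finite undirected graph without loops or multiple edges, with vertex set $X$, where $\Gamma x$ is the set of neighbours of $x$, $\Gamma A=\bigcup_{x\in A}\Gamma x$ for $A\subseteq X$, and $M$ assigns to each vertex $x$ a non-negative integer weight $\mu(x)$. For $A\subseteq X$ put $\mu(A)=\sum_{x\in A}\mu(x)$. A set $U\subseteq X$ is independent if $U\cap\Gamma U=\emptyset$; it is a maximal independent set (MIS) if in addition $U\cup\Gamma U=X$. A MIS that maximizes $\mu(U)$ among all MISs is called a maximum independent set (MMIS). $G$ is normal if $\Gamma x\neq\Gamma y$ for any two distinct vertices $x,y$. Adjacent vertices $x_1,x_2$ of a normal graph are orthogonal if $\Gamma x_2\subseteq\Gamma x_{i_1}$ for every $x_{i_1}\in\Gamma x_1\setminus\{x_2\}$ and $\Gamma x_1\subseteq\Gamma x_{i_2}$ for every $x_{i_2}\in\Gamma x_2\setminus\{x_1\}$ (each condition vacuous if there are no such vertices). A normal vertex-weighted graph is twin-orthogonal if its vertex set can be partitioned into pairs of orthogonal vertices. A twin-orthogonal graph is trivial if $\mu(x_i)=\mu(x_j)$ for any orthogonal vertices $x_i,x_j\in X$. -}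

module Defs where

open import Data.Nat using (ℕ; _≤_)
open import Data.Nat.ListAction using (sum)
open import Data.Fin using (Fin)
open import Data.Fin.Subset
open import Data.Fin.Subset.Properties using (_∈?_)
open import Data.List using (List; allFin; filter; map)
open import Data.List.Relation.Unary.All using (All)
open import Data.List.Relation.Unary.AllPairs using (AllPairs)
open import Data.Product using (∃; ∃₂; _×_)
open import Relation.Binary.PropositionalEquality using (_≡_; _≢_)

elements : ∀ {n} → Subset n → List (Fin n)
elements {n} A = filter (_∈? A) (allFin n)

-- Blocks are nonempty, so no block can be repeated in the list.
IsPartition : ∀ {n} → List (Subset n) → Set
IsPartition P = All Nonempty P × AllPairs (λ A B → A ∩ B ≡ ⊥) P × ⋃ P ≡ ⊤

-- The vertex set X is Fin n.  Storing neighbourhoods as subsets excludes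
-- multiple edges.
record VertexWeightedGraph (n : ℕ) : Set where
  field
    Γ        : Fin n → Subset n
    Γ-irrefl : ∀ {x} → x ∉ Γ x
    Γ-sym    : ∀ {x y} → y ∈ Γ x → x ∈ Γ y
    μ        : Fin n → ℕ

  Γ[_] : Subset n → Subset n
  Γ[ A ] = ⋃ (map Γ (elements A))

  μ[_] : Subset n → ℕ
  μ[ A ] = sum (map μ (elements A))

  Independent : Subset n → Set
  Independent U = U ∩ Γ[ U ] ≡ ⊥

  MIS : Subset n → Set
  MIS U = Independent U × U ∪ Γ[ U ] ≡ ⊤

  MMIS : Subset n → Set
  MMIS U = MIS U × (∀ V → MIS V → μ[ V ] ≤ μ[ U ])

  Normal : Set
  Normal = ∀ {x y} → x ≢ y → Γ x ≢ Γ y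

  -- Only used for normal graphs; normality is part of TwinOrthogonal.
  Orthogonal : Fin n → Fin n → Set
  Orthogonal x₁ x₂ =
    x₂ ∈ Γ x₁
    × (∀ {y} → y ∈ Γ x₁ - x₂ → Γ x₂ ⊆ Γ y)
    × (∀ {y} → y ∈ Γ x₂ - x₁ → Γ x₁ ⊆ Γ y)

  -- The two vertices are distinct, since orthogonal vertices are adjacent
  -- and there are no loops.
  OrthogonalPair : Subset n → Set
  OrthogonalPair B = ∃₂ λ x₁ x₂ → Orthogonal x₁ x₂ × B ≡ ⁅ x₁ ⁆ ∪ ⁅ x₂ ⁆

  TwinOrthogonal : Set
  TwinOrthogonal = Normal × ∃ λ P → IsPartition P × All OrthogonalPair P

  TrivialTwinOrthogonal : Set
  TrivialTwinOrthogonal =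
    TwinOrthogonal × (∀ {x y} → Orthogonal x y → μ x ≡ μ y)

{-# OPTIONS --safe #-}
-- A MIS U meets every orthogonal pair {x₁, x₂} in exactly one vertex: not both,
-- as x₁ and x₂ are adjacent; and if it met neither, x₁ and x₂ would have
-- neighbours u₁ ∈ U and u₂ ∈ U other than x₂ and x₁, and orthogonality would give
-- u₂ ∈ Γ x₂ ⊆ Γ u₁, against independence.  When the weights within each
-- pair agree, μ(U) is thus the sum over the pairs of the common weight, the
-- same for all U.
module Submission where

open import Defs
open import Data.Nat using (ℕ; _+_)
open import Data.Nat.ListAction using (sum)
open import Data.Nat.Properties using (+-assoc; +-identityʳ; ≤-reflexive; +-commutativeSemigroup)
open import Algebra.Properties.CommutativeSemigroup +-commutativeSemigroup
  using (x∙yz≈y∙xz)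
open import Data.Fin using (Fin)
open import Data.Fin.Subset
open import Data.Fin.Subset.Properties
open import Data.List using ([]; _∷_; [_]; allFin; filter; map)
open import Data.List.Membership.Propositional using (find; lose)
  renaming (_∈_ to _∈ˡ_)
open import Data.List.Membership.Propositional.Properties
  using (∈-filter⁺; ∈-filter⁻; ∈-allFin)
open import Data.List.Properties using (filter-accept; filter-reject; filter-none)
open import Data.List.Relation.Unary.All as All using (All; []; _∷_)
open import Data.List.Relation.Unary.AllPairs using (AllPairs; []; _∷_)
open import Data.List.Relation.Unary.Any using (Any; here; there)
import Data.List.Relation.Unary.Any.Properties as Anyₚ
open import Data.List.Relation.Unary.Unique.Propositional using (Unique)
open import Data.List.Relation.Unary.Unique.Propositional.Properties using (allFin⁺)
open import Data.Product using (∃; _×_; _,_; proj₁; proj₂)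
open import Data.Sum using (_⊎_; inj₁; inj₂; [_,_]′)
open import Function using (_∘_)
open import Relation.Nullary using (yes; no; contradiction)
open import Relation.Binary.PropositionalEquality
  using (_≡_; _≢_; refl; sym; trans; cong; cong₂; subst; module ≡-Reasoning)
open VertexWeightedGraph

private variable
  n : ℕ

disjoint⇒∉ : ∀ {A B : Subset n} {x} → A ∩ B ≡ ⊥ → x ∈ A → x ∉ B
disjoint⇒∉ A∩B≡⊥ x∈A x∈B = ∉⊥ (subst (_ ∈_) A∩B≡⊥ (x∈p∩q⁺ (x∈A , x∈B)))

x∈⋃⁺ : ∀ {x : Fin n} {As} → Any (x ∈_) As → x ∈ ⋃ As
x∈⋃⁺ (here x∈A)   = x∈p∪q⁺ (inj₁ x∈A)
x∈⋃⁺ (there x∈As) = x∈p∪q⁺ (inj₂ (x∈⋃⁺ x∈As))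

x∈⋃⁻ : ∀ {x : Fin n} As → x ∈ ⋃ As → Any (x ∈_) As
x∈⋃⁻ []       x∈⊥ = contradiction x∈⊥ ∉⊥
x∈⋃⁻ (A ∷ As) x∈∪ = [ here , there ∘ x∈⋃⁻ As ]′ (x∈p∪q⁻ A (⋃ As) x∈∪)

-- Lets the first block of a partition be split off from the union of the others in one disjoint
-- step.
∩-⋃-disjoint : ∀ {A : Subset n} {Bs} → All (λ B → A ∩ B ≡ ⊥) Bs → A ∩ ⋃ Bs ≡ ⊥
∩-⋃-disjoint {A = A} []                     = ∩-zeroʳ A
∩-⋃-disjoint {A = A} (_∷_ {B} {Bs} A∩B≡⊥ ds) = begin
  A ∩ (B ∪ ⋃ Bs)        ≡⟨ ∩-distribˡ-∪ A B (⋃ Bs) ⟩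
  (A ∩ B) ∪ (A ∩ ⋃ Bs)  ≡⟨ cong₂ _∪_ A∩B≡⊥ (∩-⋃-disjoint ds) ⟩
  ⊥ ∪ ⊥                 ≡⟨ ∪-identityˡ ⊥ ⟩
  ⊥                     ∎
  where open ≡-Reasoning

∩-disjoint : ∀ (U : Subset n) {A B} → A ∩ B ≡ ⊥ → (U ∩ A) ∩ (U ∩ B) ≡ ⊥
∩-disjoint U {A} {B} A∩B≡⊥ = ⊆-antisym
  (λ x∈ → let x∈U∩A , x∈U∩B = x∈p∩q⁻ (U ∩ A) (U ∩ B) x∈ in
    contradiction (proj₂ (x∈p∩q⁻ U B x∈U∩B))
                  (disjoint⇒∉ A∩B≡⊥ (proj₂ (x∈p∩q⁻ U A x∈U∩A))))
  (⊆-min _)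

∩-pair : ∀ {U : Subset n} {x y} → x ∈ U → y ∉ U → U ∩ (⁅ x ⁆ ∪ ⁅ y ⁆) ≡ ⁅ x ⁆
∩-pair {U = U} {x} {y} x∈U y∉U = ⊆-antisym to from
  where
  to : U ∩ (⁅ x ⁆ ∪ ⁅ y ⁆) ⊆ ⁅ x ⁆
  to z∈ with z∈U , z∈xy ← x∈p∩q⁻ U _ z∈ with x∈p∪q⁻ ⁅ x ⁆ ⁅ y ⁆ z∈xy
  ... | inj₁ z∈x = z∈x
  ... | inj₂ z∈y = contradiction (subst (_∈ U) (x∈⁅y⁆⇒x≡y y z∈y) z∈U) y∉U

  from : ⁅ x ⁆ ⊆ U ∩ (⁅ x ⁆ ∪ ⁅ y ⁆)
  from z∈x = x∈p∩q⁺
    (subst (_∈ U) (sym (x∈⁅y⁆⇒x≡y x z∈x)) x∈U , x∈p∪q⁺ (inj₁ z∈x))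

-- Uniqueness rules out a second copy of `x`, so the weight of a singleton is a sum with a single
-- term.
filter-singleton : ∀ {x : Fin n} {xs} → Unique xs → x ∈ˡ xs →
                   filter (_∈? ⁅ x ⁆) xs ≡ [ x ]
filter-singleton {x = x} (x∉xs ∷ _) (here refl) = trans
  (filter-accept (_∈? ⁅ x ⁆) (x∈⁅x⁆ x))
  (cong (x ∷_) (filter-none (_∈? ⁅ x ⁆)
    (All.map (λ x≢y y∈x → x≢y (sym (x∈⁅y⁆⇒x≡y x y∈x))) x∉xs)))
filter-singleton {x = x} (y∉xs ∷ xs!) (there x∈xs) = trans
  (filter-reject (_∈? ⁅ x ⁆)
    (λ y∈x → All.lookup y∉xs x∈xs (x∈⁅y⁆⇒x≡y x y∈x)))
  (filter-singleton xs! x∈xs)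

-- Additivity of weight on disjoint sets. The list is arbitrary so that induction applies; `μ[_]` is
-- the case of `allFin`.
sum-filter-∪ : ∀ (f : Fin n → ℕ) {A B : Subset n} → A ∩ B ≡ ⊥ → ∀ xs →
               sum (map f (filter (_∈? A ∪ B) xs)) ≡
               sum (map f (filter (_∈? A) xs)) + sum (map f (filter (_∈? B) xs))
sum-filter-∪ f A∩B≡⊥ [] = refl
sum-filter-∪ f {A} {B} A∩B≡⊥ (x ∷ xs)
  -- These case splits evaluate the two filters on the right; the filter over `A ∪ B` is evaluated
  -- by a rewrite in each case.
  with ih ← sum-filter-∪ f A∩B≡⊥ xs | x ∈? A | x ∈? B
... | yes x∈A | yes x∈B = contradiction x∈B (disjoint⇒∉ A∩B≡⊥ x∈A)
... | yes x∈A | no  _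
  rewrite filter-accept (_∈? A ∪ B) {xs = xs} (x∈p∪q⁺ {p = A} {B} (inj₁ x∈A)) =
  trans (cong (f x +_) ih) (sym (+-assoc (f x) _ _))
... | no  _   | yes x∈B
  rewrite filter-accept (_∈? A ∪ B) {xs = xs} (x∈p∪q⁺ {p = A} {B} (inj₂ x∈B)) =
  trans (cong (f x +_) ih)
        (x∙yz≈y∙xz (f x) (sum (map f (filter (_∈? A) xs))) _)
... | no x∉A  | no x∉B
  rewrite filter-reject (_∈? A ∪ B) {xs = xs} ([ x∉A , x∉B ]′ ∘ x∈p∪q⁻ A B) = ih

module _ (G : VertexWeightedGraph n) where

  x∈Γ[A]⁺ : ∀ {A x y} → y ∈ A → x ∈ Γ G y → x ∈ Γ[_] G A
  x∈Γ[A]⁺ {A} {y = y} y∈A x∈Γy =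
    x∈⋃⁺ (Anyₚ.map⁺ (lose (∈-filter⁺ (_∈? A) (∈-allFin y) y∈A) x∈Γy))

  x∈Γ[A]⁻ : ∀ {A x} → x ∈ Γ[_] G A → ∃ λ y → y ∈ A × x ∈ Γ G y
  x∈Γ[A]⁻ {A} x∈ with y , y∈ , x∈Γy ← find (Anyₚ.map⁻ (x∈⋃⁻ _ x∈)) =
    y , proj₂ (∈-filter⁻ (_∈? A) {xs = allFin _} y∈) , x∈Γy

  independent⇒nonadjacent : ∀ {U x y} → Independent G U →
                            x ∈ U → y ∈ U → y ∉ Γ G x
  independent⇒nonadjacent ind x∈U y∈U y∈Γx =
    disjoint⇒∉ ind y∈U (x∈Γ[A]⁺ x∈U y∈Γx)

  -- Maximality puts `x` in `Γ[ U ]`, and symmetry of adjacency turns a neighbourhood containing `x`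
  -- into a neighbour of `x`.
  MIS-dominating : ∀ {U x} → MIS G U → x ∉ U → ∃ λ u → u ∈ U × u ∈ Γ G x
  MIS-dominating {U} {x} (_ , U∪Γ[U]≡⊤) x∉U
    with x∈p∪q⁻ U _ (subst (x ∈_) (sym U∪Γ[U]≡⊤) ∈⊤)
  ... | inj₁ x∈U = contradiction x∈U x∉U
  ... | inj₂ x∈Γ[U] with u , u∈U , x∈Γu ← x∈Γ[A]⁻ x∈Γ[U] = u , u∈U , Γ-sym G x∈Γu

  MIS-meets-orthogonal : ∀ {U x y} → MIS G U → Orthogonal G x y →
                         (x ∈ U × y ∉ U) ⊎ (y ∈ U × x ∉ U)
  MIS-meets-orthogonal {U} {x} {y} mis@(ind , _) (y∈Γx , Γy⊆ , _)
    with x ∈? U | y ∈? U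
  ... | yes x∈U | yes y∈U = contradiction y∈Γx (independent⇒nonadjacent ind x∈U y∈U)
  ... | yes x∈U | no  y∉U = inj₁ (x∈U , y∉U)
  ... | no  x∉U | yes y∈U = inj₂ (y∈U , x∉U)
  ... | no  x∉U | no  y∉U
    with u , u∈U , u∈Γx ← MIS-dominating mis x∉U
       | v , v∈U , v∈Γy ← MIS-dominating mis y∉U =
    -- `u` and `v` may coincide: independence forbids `v ∈ Γ u` in that case as well.
    contradiction (Γy⊆ (x∈p∧x≢y⇒x∈p-y u∈Γx u≢y) v∈Γy)
                  (independent⇒nonadjacent ind u∈U v∈U)
    where
    u≢y : u ≢ y
    u≢y u≡y = y∉U (subst (_∈ U) u≡y u∈U)

  μ-singleton : ∀ x → μ[_] G ⁅ x ⁆ ≡ μ G x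
  μ-singleton x = trans
    (cong (sum ∘ map (μ G)) (filter-singleton (allFin⁺ _) (∈-allFin x)))
    (+-identityʳ (μ G x))

  -- The equal weights make the value independent of which vertex of the pair `U` contains, hence of
  -- `U` itself.
  μ-MIS∩orthogonal : ∀ {U x y} → MIS G U → Orthogonal G x y → μ G x ≡ μ G y →
                     μ[_] G (U ∩ (⁅ x ⁆ ∪ ⁅ y ⁆)) ≡ μ G x
  μ-MIS∩orthogonal {U} {x} {y} mis x⊥y μx≡μy with MIS-meets-orthogonal mis x⊥y
  ... | inj₁ (x∈U , y∉U) = trans (cong (μ[_] G) (∩-pair x∈U y∉U)) (μ-singleton x)
  ... | inj₂ (y∈U , x∉U) = begin
    -- `∩-pair` expects the vertex lying in `U` to come first.
    μ[_] G (U ∩ (⁅ x ⁆ ∪ ⁅ y ⁆))  ≡⟨ cong (λ B → μ[_] G (U ∩ B)) (∪-comm ⁅ x ⁆ ⁅ y ⁆) ⟩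
    μ[_] G (U ∩ (⁅ y ⁆ ∪ ⁅ x ⁆))  ≡⟨ cong (μ[_] G) (∩-pair y∈U x∉U) ⟩
    μ[_] G ⁅ y ⁆                  ≡⟨ μ-singleton y ⟩
    μ G y                         ≡⟨ μx≡μy ⟨
    μ G x                         ∎
    where open ≡-Reasoning

  μ-∩-∪ : ∀ U {A B} → A ∩ B ≡ ⊥ →
          μ[_] G (U ∩ (A ∪ B)) ≡ μ[_] G (U ∩ A) + μ[_] G (U ∩ B)
  μ-∩-∪ U {A} {B} A∩B≡⊥ = trans
    (cong (μ[_] G) (∩-distribˡ-∪ U A B))
    (sum-filter-∪ (μ G) (∩-disjoint U A∩B≡⊥) (allFin _))

  -- Induction on the list of blocks, with weight additive at each step. Comparing `U` with `V`
  -- directly avoids naming the common total.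
  μ-∩-⋃-cong : ∀ {U V P} → AllPairs (λ A B → A ∩ B ≡ ⊥) P →
               All (λ B → μ[_] G (U ∩ B) ≡ μ[_] G (V ∩ B)) P →
               μ[_] G (U ∩ ⋃ P) ≡ μ[_] G (V ∩ ⋃ P)
  μ-∩-⋃-cong {U} {V} [] [] = cong (μ[_] G) (trans (∩-zeroʳ U) (sym (∩-zeroʳ V)))
  μ-∩-⋃-cong {U} {V} {B ∷ P} (d ∷ ds) (e ∷ es) = begin
    μ[_] G (U ∩ (B ∪ ⋃ P))               ≡⟨ μ-∩-∪ U (∩-⋃-disjoint d) ⟩
    μ[_] G (U ∩ B) + μ[_] G (U ∩ ⋃ P)    ≡⟨ cong₂ _+_ e (μ-∩-⋃-cong ds es) ⟩
    μ[_] G (V ∩ B) + μ[_] G (V ∩ ⋃ P)    ≡⟨ μ-∩-∪ V (∩-⋃-disjoint d) ⟨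
    μ[_] G (V ∩ (B ∪ ⋃ P))               ∎
    where open ≡-Reasoning

  MIS-μ-unique : TrivialTwinOrthogonal G → ∀ {U V} → MIS G U → MIS G V →
                 μ[_] G U ≡ μ[_] G V
  MIS-μ-unique ((_ , P , (_ , disj , ⋃P≡⊤) , pairs) , triv) {U} {V} misU misV = begin
    μ[_] G U          ≡⟨ cong (μ[_] G) (∩-⋃P U) ⟨
    μ[_] G (U ∩ ⋃ P)  ≡⟨ μ-∩-⋃-cong disj (All.map block pairs) ⟩
    μ[_] G (V ∩ ⋃ P)  ≡⟨ cong (μ[_] G) (∩-⋃P V) ⟩
    μ[_] G V          ∎
    where
    open ≡-Reasoning

    ∩-⋃P : ∀ W → W ∩ ⋃ P ≡ W
    ∩-⋃P W = trans (cong (W ∩_) ⋃P≡⊤) (∩-identityʳ W)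

    block : ∀ {B} → OrthogonalPair G B → μ[_] G (U ∩ B) ≡ μ[_] G (V ∩ B)
    -- Both sides equal the weight of the first vertex of the pair.
    block (_ , _ , x⊥y , refl) = trans
      (μ-MIS∩orthogonal misU x⊥y (triv x⊥y))
      (sym (μ-MIS∩orthogonal misV x⊥y (triv x⊥y)))

theorem4p2 : ∀ {n : ℕ} (G : VertexWeightedGraph n) → TrivialTwinOrthogonal G →
    ∀ (U : Subset n) → MIS G U → MMIS G U
theorem4p2 G tto U misU =
  -- All MISs have the same weight, so each one attains the maximum.
  misU , λ V misV → ≤-reflexive (MIS-μ-unique G tto misV misU)
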